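{- Let $\mathcal{G}$ be a class of graphs and let $\mathcal{M}$ be the class of cycle matroids $M(G)$ for $G\in\mathcal{G}$. If $\mathcal{G}$ has locally bounded tree-width, then $\mathcal{M}$ has locally bounded branch-width.
   Context: For a graph $G$ and vertex $v$, $N^G_d(v)$ is the set of vertices at distance at most $d$ from $v$. A class $\mathcal{G}$ of graphs has locally bounded tree-width if there is a function $f:\mathbb{N}\to\mathbb{N}$ such that for every $G\in\mathcal{G}$, every vertex $v$ of $G$ and every non-negative integer $d$, the subgraph of $G$ induced by $N^G_d(v)$ has tree-width at most $f(d)$. The cycle matroid $M(G)$ has ground set $E(G)$, a set of edges being independent iff it contains no cycle. Branch-width of a matroid $M$ with rank function $r$: a branch-decomposition is a tree with internal nodes of degree at most 3 whose leaves correspond one-to-one to elements of $M$; a tree edge splitting the elements into $A,B$ has width $r(A)+r(B)-r(M)+1$; the width of the decomposition is the maximum edge width, and the branch-width is the minimum width over all branch-decompositions. The distance of two distinct elements $e,f$ of a matroid $M$ is the minimum size of a circuit containing both (distance of $e$ to itself is $0$); $N^M_d(e)$ is the set of elements at distance at most $d$ from $e$. A class $\mathcal{M}$ of matroids has locally bounded branch-width if there is $f:\mathbb{N}\to\mathbb{N}$ such that for every $M\in\mathcal{M}$, every element $e$ and every positive integer $d$, the restriction of $M$ to $N^M_d(e)$ has branch-width at most $f(d)$. -}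

module Defs where

open import Data.Nat using (ℕ; zero; suc; _+_; _≤_)
open import Data.Fin using (Fin; zero; suc; toℕ; inject₁; fromℕ; _≟_)
open import Data.Fin.Subset using (Subset; _∈_; _⊆_; _⊂_; ∣_∣)
open import Data.Vec using (tabulate)
open import Data.Product using (Σ; ∃; _×_; _,_; proj₁; proj₂)
open import Data.Sum using (_⊎_)
open import Data.Unit using (⊤)
open import Function.Definitions using (Injective)
open import Relation.Nullary using (¬_)
open import Relation.Nullary.Decidable using (⌊_⌋)
open import Relation.Binary.PropositionalEquality using (_≡_)

-- Finite (multi)graphs: vertices Fin n, edges Fin m, each edge has an
-- (unordered) pair of endpoints; loops and parallel edges are allowed.

record Graph : Set where
  field
    n    : ℕ
    m    : ℕ
    ends : Fin m → Fin n × Fin n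

open Graph public

Joins : (G : Graph) → Fin (m G) → Fin (n G) → Fin (n G) → Set
Joins G e u w = (ends G e ≡ (u , w)) ⊎ (ends G e ≡ (w , u))

data Walk (G : Graph) (OkV : Fin (n G) → Set) (OkE : Fin (m G) → Set)
     : ℕ → Fin (n G) → Fin (n G) → Set where
  stop : ∀ {d v} → OkV v → Walk G OkV OkE d v v
  step : ∀ {d u w v} (e : Fin (m G)) → OkE e → OkV u → Joins G e u w →
         Walk G OkV OkE d w v → Walk G OkV OkE (suc d) u v

Reach : (G : Graph) → (Fin (n G) → Set) → (Fin (m G) → Set) →
        Fin (n G) → Fin (n G) → Set
Reach G OkV OkE u v = Σ ℕ λ d → Walk G OkV OkE d u v

Ball : (G : Graph) → ℕ → Fin (n G) → Fin (n G) → Set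
Ball G d v u = Walk G (λ _ → ⊤) (λ _ → ⊤) d v u

-- degree of a vertex (a loop counts twice)
degree : (G : Graph) → Fin (n G) → ℕ
degree G x = ∣ tabulate (λ j → ⌊ proj₁ (ends G j) ≟ x ⌋) ∣
           + ∣ tabulate (λ j → ⌊ proj₂ (ends G j) ≟ x ⌋) ∣

-- Trees.  A tree on t+1 nodes is presented by a parent array: node
-- (suc i) has parent (parent i), whose index is at most i.  Every finite
-- tree is isomorphic to such a tree (root it and number in BFS order).

record Tree : Set where
  field
    t       : ℕ
    parent  : Fin t → Fin (suc t)
    parent≤ : ∀ i → toℕ (parent i) ≤ toℕ i

open Tree public

treeGraph : Tree → Graph
treeGraph T = record { n = suc (t T) ; m = t T ; ends = λ i → (suc i , parent T i) }

Node : Tree → Set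
Node T = Fin (suc (t T))

record TreeDec (G : Graph) (S : Fin (n G) → Set) (k : ℕ) : Set where
  field
    T       : Tree
    bag     : Node T → Subset (n G)
    bag⊆S   : ∀ x v → v ∈ bag x → S v
    cover-v : ∀ v → S v → ∃ λ x → v ∈ bag x
    cover-e : ∀ e → S (proj₁ (ends G e)) → S (proj₂ (ends G e)) →
              ∃ λ x → proj₁ (ends G e) ∈ bag x × proj₂ (ends G e) ∈ bag x
    conn    : ∀ v x y → v ∈ bag x → v ∈ bag y →
              Reach (treeGraph T) (λ z → v ∈ bag z) (λ _ → ⊤) x y
    width   : ∀ x → ∣ bag x ∣ ≤ suc k

TWAtMost : (G : Graph) → (Fin (n G) → Set) → ℕ → Set
TWAtMost G S k = TreeDec G S k

LocallyBoundedTW : (Graph → Set) → Set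
LocallyBoundedTW 𝒢 =
  Σ (ℕ → ℕ) λ f → ∀ G → 𝒢 G → ∀ (v : Fin (n G)) (d : ℕ) →
    TWAtMost G (Ball G d v) (f d)

-- Matroids, given by ground set Fin m and an independence predicate on
-- subsets.  (Only cycle matroids occur below; the notions are defined
-- from the independence predicate exactly as for general matroids.)

record Matroid : Set₁ where
  field
    size  : ℕ
    Indep : Subset size → Set

open Matroid public

record Cycle (G : Graph) : Set where
  field
    len   : ℕ
    vtx   : Fin (suc len) → Fin (n G)
    edg   : Fin (suc len) → Fin (m G)
    vinj  : Injective _≡_ _≡_ vtx
    einj  : Injective _≡_ _≡_ edg
    joins : ∀ (i : Fin len) → Joins G (edg (inject₁ i)) (vtx (inject₁ i)) (vtx (suc i))
    close : Joins G (edg (fromℕ len)) (vtx (fromℕ len)) (vtx zero)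

cycleMatroid : Graph → Matroid
cycleMatroid G = record
  { size  = m G
  ; Indep = λ I → ¬ (Σ (Cycle G) λ C → ∀ i → Cycle.edg C i ∈ I)
  }

IsRank : (M : Matroid) → (Fin (size M) → Set) → ℕ → Set
IsRank M A r =
  (Σ (Subset (size M)) λ I → (∀ x → x ∈ I → A x) × Indep M I × ∣ I ∣ ≡ r)
  × (∀ I → (∀ x → x ∈ I → A x) → Indep M I → ∣ I ∣ ≤ r)

Circuit : (M : Matroid) → Subset (size M) → Set
Circuit M C = ¬ Indep M C × (∀ D → D ⊂ C → Indep M D)

MBall : (M : Matroid) → ℕ → Fin (size M) → Fin (size M) → Set
MBall M d e f =
  (f ≡ e) ⊎ (Σ (Subset (size M)) λ C → Circuit M C × e ∈ C × f ∈ C × ∣ C ∣ ≤ d)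

-- A branch-decomposition of the restriction M|X of width at most k.
-- Leaves (degree ≤ 1) correspond one-to-one to elements of X via `leaf`
-- (values of `leaf` outside X are irrelevant).  Removing tree edge j
-- splits X into the elements whose leaf is reachable from the endpoint
-- (suc j) without using edge j (side A) and the rest (side B).
-- Width condition r(A) + r(B) - r(X) + 1 ≤ k is written without
-- truncated subtraction as r(A) + r(B) + 1 ≤ k + r(X); ranks in M|X are
-- the ranks in M of subsets of X.
record BranchDec (M : Matroid) (X : Fin (size M) → Set) (k : ℕ) : Set where
  field
    T         : Tree
    leaf      : Fin (size M) → Node T
    leaf-inj  : ∀ e f → X e → X f → leaf e ≡ leaf f → e ≡ f
    leaf-leaf : ∀ e → X e → degree (treeGraph T) (leaf e) ≤ 1
    leaf-onto : ∀ x → degree (treeGraph T) x ≤ 1 → ∃ λ e → X e × leaf e ≡ x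
    deg≤3     : ∀ x → degree (treeGraph T) x ≤ 3
  SideA : Fin (t T) → Fin (size M) → Set
  SideA j e = X e × Reach (treeGraph T) (λ _ → ⊤) (λ i → ¬ (i ≡ j)) (suc j) (leaf e)
  SideB : Fin (t T) → Fin (size M) → Set
  SideB j e = X e × ¬ Reach (treeGraph T) (λ _ → ⊤) (λ i → ¬ (i ≡ j)) (suc j) (leaf e)
  field
    width : ∀ j ra rb rX → IsRank M (SideA j) ra → IsRank M (SideB j) rb →
            IsRank M X rX → ra + rb + 1 ≤ k + rX

BWAtMost : (M : Matroid) → (Fin (size M) → Set) → ℕ → Set
BWAtMost M X k = BranchDec M X k

LocallyBoundedBW : (Matroid → Set₁) → Set₁
LocallyBoundedBW 𝓜 =
  Σ (ℕ → ℕ) λ f → ∀ M → 𝓜 M → ∀ (e : Fin (size M)) (d : ℕ) → 1 ≤ d →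
    BWAtMost M (MBall M d e) (f d)

CycleMatroidsOf : (Graph → Set) → Matroid → Set₁
CycleMatroidsOf 𝒢 M = Σ Graph λ G → 𝒢 G × (M ≡ cycleMatroid G)

{-# OPTIONS --safe #-}

-- A circuit of size at most d through e is a cycle, so all its vertices lie in
-- the ball of radius 2d around an end of e, and that ball has a tree-decomposition
-- of bounded width. Hang every element of the matroid ball on a node whose bag
-- contains both its ends, and contract the decomposition tree into its root from
-- the last node on, joining the binary trees hanging at the two merged nodes. Every
-- subtree of the result holds a set A of elements that meets its complement B only
-- in vertices of one bag W, and r(A) + r(B) ≤ r(A ∪ B) + |W|.
module Submission where

open import Defs
open import Data.Bool using (Bool; true; false)
open import Data.Empty using (⊥-elim)
open import Data.Fin using (Fin; zero; suc; inject₁; fromℕ; fromℕ<; toℕ; splitAt; _↑ˡ_; _↑ʳ_; _≟_)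
open import Data.Fin.Properties using (any?; suc-injective; fromℕ≢inject₁; inject₁-injective; toℕ-injective; toℕ-fromℕ<; toℕ≤pred[n]; toℕ-↑ˡ; toℕ-↑ʳ; splitAt-↑ˡ; splitAt-↑ʳ; splitAt⁻¹-↑ˡ; splitAt⁻¹-↑ʳ; ↑ˡ-injective; ↑ʳ-injective)
open import Data.Fin.Relation.Unary.Top using (view; ‵fromℕ; ‵inject₁)
open import Data.Fin.Subset using (Subset; inside; outside; ∣_∣; _-_; _∪_; ⁅_⁆) renaming (_∈_ to _∈ˢ_; ⊥ to ∅)
open import Data.Fin.Subset.Properties using (x∈p⇒∣p-x∣<∣p∣; x∈p⇒p-x⊂p; x∈p∧x≢y⇒x∈p-y; x∈p∪q⁻; x∈p∪q⁺; x∈⁅y⁆⇒x≡y; x∈⁅x⁆; ∉⊥; anySubset?; _⊂?_) renaming (_∈?_ to _∈ˢ?_)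
open import Data.List using (List; []; _∷_; _++_; length; map; filter; allFin)
import Data.List.Membership.DecPropositional as DecMembership
open import Data.List.Membership.Propositional using (_∈_; _∉_)
open import Data.List.Membership.Propositional.Properties using (∈-map⁺; ∈-map⁻; ∈-++⁻; ∈-++⁺ˡ; ∈-++⁺ʳ; ∈-tabulate⁻; ∈-filter⁺; ∈-filter⁻; ∈-allFin)
open import Data.List.Properties using (length-map; length-tabulate; ++-identityʳ)
import Data.List.Relation.Unary.All as All
open import Data.List.Relation.Unary.AllPairs using ([]; _∷_)
open import Data.List.Relation.Unary.Any using (here; there)
open import Data.List.Relation.Unary.Unique.Propositional using (Unique)
open import Data.List.Relation.Unary.Unique.Propositional.Properties using () renaming (map⁺ to Unique-map⁺; ++⁺ to Unique-++⁺; tabulate⁺ to Unique-tabulate⁺; filter⁺ to Unique-filter⁺; allFin⁺ to Unique-allFin⁺)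
open import Data.Maybe using (Maybe; just; nothing)
open import Data.Nat using (ℕ; zero; suc; pred; _+_; _≤_; z≤n; s≤s)
open import Data.Nat.Properties using (≤-trans; ≤-refl; ≤-reflexive; ≤-pred; ≤∧≢⇒<; <⇒≤; <-irrefl; +-suc; +-comm; +-identityʳ; +-mono-≤; +-monoˡ-≤; +-monoʳ-≤; m≤n⇒m≤1+n; m≤n+m; m≤m+n; _≤?_; module ≤-Reasoning)
open import Data.Product using (Σ; ∃; ∃₂; _×_; _,_; proj₁; proj₂)
open import Data.Sum using (_⊎_; inj₁; inj₂; [_,_]′)
open import Data.Unit using (⊤; tt)
open import Data.Vec using (Vec; []; _∷_; lookup; here; there; tabulate)
open import Data.Vec.Properties using (tabulate-cong)
open import Function using (_∘_; id)
open import Relation.Nullary using (¬_; Dec; yes; no)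
open import Relation.Nullary.Decidable using (⌊_⌋; ¬?; _×-dec_; _⊎-dec_; decidable-stable; map′)
open import Relation.Binary.PropositionalEquality using (_≡_; _≢_; refl; sym; trans; cong; cong₂; subst)

-- Three requirements shape the construction. A branch-decomposition has no leaf without an element,
-- while many nodes of the tree-decomposition receive none; so the tree hanging at a node is a
-- `Maybe`, and joining with an empty one adds no node. The leaves come from a list of the elements
-- of the matroid ball, so membership in that ball has to be decided, although it asks for a circuit
-- and independence is a negation; the greedy forest algorithm decides independence and produces a
-- cycle where it fails. Contraction goes from the last node down because parents have smaller
-- indices: the node removed is then a leaf of what remains, and the nodes merged into its parent
-- touch all other nodes only through that parent, whose bag is therefore the cut.

-- Subsets as duplicate-free lists, and labels along a path.

elements : ∀ {n} → Subset n → List (Fin n)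
elements []            = []
elements (inside  ∷ p) = zero ∷ map suc (elements p)
elements (outside ∷ p) = map suc (elements p)

length-elements : ∀ {n} (p : Subset n) → length (elements p) ≡ ∣ p ∣
length-elements []            = refl
length-elements (inside  ∷ p) = cong suc (trans (length-map suc (elements p)) (length-elements p))
length-elements (outside ∷ p) = trans (length-map suc (elements p)) (length-elements p)

∈-elements⁺ : ∀ {n} {p : Subset n} {x} → x ∈ˢ p → x ∈ elements p
∈-elements⁺ {p = inside  ∷ p} here      = here refl
∈-elements⁺ {p = inside  ∷ p} (there i) = there (∈-map⁺ suc (∈-elements⁺ i))
∈-elements⁺ {p = outside ∷ p} (there i) = ∈-map⁺ suc (∈-elements⁺ i)

∈-elements⁻ : ∀ {n} {p : Subset n} {x} → x ∈ elements p → x ∈ˢ p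
∈-elements⁻ {p = inside ∷ p} (here refl) = here
∈-elements⁻ {p = inside ∷ p} (there i) with ∈-map⁻ suc i
... | _ , j , refl = there (∈-elements⁻ j)
∈-elements⁻ {p = outside ∷ p} i with ∈-map⁻ suc i
... | _ , j , refl = there (∈-elements⁻ j)

elements-unique : ∀ {n} (p : Subset n) → Unique (elements p)
elements-unique []            = []
elements-unique (inside  ∷ p) =
  All.tabulate (λ i → λ { refl → 0∉ (∈-map⁻ suc i) }) ∷ Unique-map⁺ suc-injective (elements-unique p)
  where
  0∉ : ∀ {n} {xs : List (Fin n)} → ¬ ∃ λ x → x ∈ xs × zero ≡ suc x
  0∉ (_ , _ , ())
elements-unique (outside ∷ p) = Unique-map⁺ suc-injective (elements-unique p)

fromList : ∀ {n} → List (Fin n) → Subset n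
fromList []       = ∅
fromList (x ∷ xs) = ⁅ x ⁆ ∪ fromList xs

∈-fromList⁺ : ∀ {n} {xs : List (Fin n)} {x} → x ∈ xs → x ∈ˢ fromList xs
∈-fromList⁺ (here refl) = x∈p∪q⁺ (inj₁ (x∈⁅x⁆ _))
∈-fromList⁺ (there i)   = x∈p∪q⁺ (inj₂ (∈-fromList⁺ i))

∈-fromList⁻ : ∀ {n} (xs : List (Fin n)) {x} → x ∈ˢ fromList xs → x ∈ xs
∈-fromList⁻ []       i = ⊥-elim (∉⊥ i)
∈-fromList⁻ (y ∷ xs) i with x∈p∪q⁻ ⁅ y ⁆ (fromList xs) i
... | inj₁ j = here (x∈⁅y⁆⇒x≡y y j)
... | inj₂ j = there (∈-fromList⁻ xs j)

length≤∣p∣ : ∀ {n} {xs : List (Fin n)} (p : Subset n) →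
  Unique xs → (∀ {x} → x ∈ xs → x ∈ˢ p) → length xs ≤ ∣ p ∣
length≤∣p∣ p [] xs⊆p = z≤n
length≤∣p∣ {xs = x ∷ xs} p (x≢xs ∷ uniq) xs⊆p =
  ≤-trans (s≤s (length≤∣p∣ (p - x) uniq λ i → x∈p∧x≢y⇒x∈p-y (xs⊆p (there i)) (λ eq → All.lookup x≢xs i (sym eq))))
          (x∈p⇒∣p-x∣<∣p∣ (xs⊆p (here refl)))

∈-tail : ∀ {A : Set} {x y : A} {xs} → x ∈ y ∷ xs → x ≢ y → x ∈ xs
∈-tail (here eq) x≢y = ⊥-elim (x≢y eq)
∈-tail (there i) _   = i

path-const : ∀ {A : Set} {k} (f : Fin (suc k) → A) →
  (∀ j → f (inject₁ j) ≡ f (suc j)) → ∀ x → f zero ≡ f x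
path-const             f eq zero    = refl
path-const {k = suc k} f eq (suc x) = trans (eq zero) (path-const (f ∘ suc) (eq ∘ suc) x)

path-const-except : ∀ {A : Set} {k} (f : Fin (suc k) → A) i →
  (∀ j → j ≢ i → f (inject₁ j) ≡ f (suc j)) →
  f zero ≡ f (inject₁ i) × f (suc i) ≡ f (fromℕ k)
path-const-except {k = suc k} f zero eq =
  refl , path-const (f ∘ suc) (λ j → eq (suc j) λ ()) (fromℕ k)
path-const-except {k = suc k} f (suc i) eq
  with path-const-except (f ∘ suc) i (λ j j≢i → eq (suc j) (j≢i ∘ suc-injective))
... | p , q = trans (eq zero λ ()) p , q

-- Forests and rank in cycle matroids

module _ (G : Graph) where

  private
    V = Fin (n G)
    E = Fin (m G)

  end₁ end₂ : E → V
  end₁ e = proj₁ (ends G e)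
  end₂ e = proj₂ (ends G e)

  IsEnd : E → V → Set
  IsEnd e v = v ≡ end₁ e ⊎ v ≡ end₂ e

  IsEndOf : List E → V → Set
  IsEndOf es v = ∃ λ e → e ∈ es × IsEnd e v

  CycleIn : (E → Set) → Set
  CycleIn P = Σ (Cycle G) λ C → ∀ i → P (Cycle.edg C i)

  joins-≡ : ∀ {e u w} {A : Set} (c : V → A) → Joins G e u w → c (end₁ e) ≡ c (end₂ e) → c u ≡ c w
  joins-≡ c (inj₁ refl) eq = eq
  joins-≡ c (inj₂ refl) eq = sym eq

  joins-≡⁻ : ∀ {e u w} {A : Set} (c : V → A) → Joins G e u w → c u ≡ c w → c (end₁ e) ≡ c (end₂ e)
  joins-≡⁻ c (inj₁ refl) eq = eq
  joins-≡⁻ c (inj₂ refl) eq = sym eq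

  -- The cycle without its edge `i` is a path between the ends of that edge, and `c` is constant
  -- along it. Applied to component labels, this shows that no edge joining two components closes a
  -- cycle.
  cycle-closes : ∀ {A : Set} (c : V → A) (C : Cycle G) i →
    (∀ j → j ≢ i → c (end₁ (Cycle.edg C j)) ≡ c (end₂ (Cycle.edg C j))) →
    c (end₁ (Cycle.edg C i)) ≡ c (end₂ (Cycle.edg C i))
  cycle-closes c C i eq with view i
  ... | ‵fromℕ = joins-≡⁻ c (Cycle.close C)
        (sym (path-const (c ∘ Cycle.vtx C)
          (λ j → joins-≡ c (Cycle.joins C j) (eq (inject₁ j) λ p → fromℕ≢inject₁ (sym p))) (fromℕ _)))
  ... | ‵inject₁ i′ with path-const-except (c ∘ Cycle.vtx C) i′
          (λ j j≢i → joins-≡ c (Cycle.joins C j) (eq (inject₁ j) (j≢i ∘ inject₁-injective)))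
  ... | p , q = joins-≡⁻ c (Cycle.joins C i′)
        (trans (sym p) (trans (sym (joins-≡ c (Cycle.close C) (eq (fromℕ _) fromℕ≢inject₁))) (sym q)))

  relabel : V → V → V → V
  relabel a b x with x ≟ a
  ... | yes _ = b
  ... | no  _ = x

  relabel-ends : ∀ a b → relabel a b a ≡ relabel a b b
  relabel-ends a b with a ≟ a | b ≟ a
  ... | yes _   | yes _ = refl
  ... | yes _   | no  _ = refl
  ... | no  a≢a | _     = ⊥-elim (a≢a refl)

  relabel-≡⁻ : ∀ a b {x y} → relabel a b x ≡ relabel a b y →
    x ≡ y ⊎ (x ≡ a × b ≡ y) ⊎ (x ≡ b × a ≡ y)
  relabel-≡⁻ a b {x} {y} eq with x ≟ a | y ≟ a
  ... | yes p | yes q = inj₁ (trans p (sym q))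
  ... | yes p | no  _ = inj₂ (inj₁ (p , eq))
  ... | no  _ | yes q = inj₂ (inj₂ (eq , sym q))
  ... | no  _ | no  _ = inj₁ eq

  -- Two vertices get the same label iff they lie in one component of the graph (V , es).
  comp : List E → V → V
  comp []       v = v
  comp (e ∷ es) v = relabel (comp es (end₁ e)) (comp es (end₂ e)) (comp es v)

  comp-edge : ∀ {es e} → e ∈ es → comp es (end₁ e) ≡ comp es (end₂ e)
  comp-edge {e ∷ es} (here refl) = relabel-ends (comp es (end₁ e)) (comp es (end₂ e))
  comp-edge {e ∷ es} (there i)   = cong (relabel _ _) (comp-edge i)

  -- A vertex that no edge of `es` touches is a component by itself.
  comp-≡⇒ends : ∀ es {x y} → comp es x ≡ comp es y → x ≡ y ⊎ IsEndOf es x × IsEndOf es y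
  comp-≡⇒ends []       eq = inj₁ eq
  comp-≡⇒ends (e ∷ es) {x} {y} eq = go (relabel-≡⁻ _ _ eq)
    where
    later : ∀ {v} → IsEndOf es v → IsEndOf (e ∷ es) v
    later (f , i , end) = f , there i , end

    fst : ∀ {v} → comp es v ≡ comp es (end₁ e) → IsEndOf (e ∷ es) v
    fst p with comp-≡⇒ends es p
    ... | inj₁ refl    = e , here refl , inj₁ refl
    ... | inj₂ (q , _) = later q

    snd : ∀ {v} → comp es v ≡ comp es (end₂ e) → IsEndOf (e ∷ es) v
    snd p with comp-≡⇒ends es p
    ... | inj₁ refl    = e , here refl , inj₂ refl
    ... | inj₂ (q , _) = later q

    go : _ → x ≡ y ⊎ IsEndOf (e ∷ es) x × IsEndOf (e ∷ es) y
    go (inj₁ p) with comp-≡⇒ends es p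
    ... | inj₁ q       = inj₁ q
    ... | inj₂ (q , r) = inj₂ (later q , later r)
    go (inj₂ (inj₁ (p , q))) = inj₂ (fst p , snd (sym q))
    go (inj₂ (inj₂ (p , q))) = inj₂ (snd p , fst (sym q))

  -- Kruskal's greedy algorithm, run from the back of the list: in `as ++ bs` the edges of `bs` are
  -- treated first, so the result extends `forest bs`.
  forest : List E → List E
  forest []       = []
  forest (e ∷ es) with comp es (end₁ e) ≟ comp es (end₂ e)
  ... | yes _ = forest es
  ... | no  _ = e ∷ forest es

  forest⊆ : ∀ es {e} → e ∈ forest es → e ∈ es
  forest⊆ (e ∷ es) i with comp es (end₁ e) ≟ comp es (end₂ e)
  forest⊆ (e ∷ es) i           | yes _ = there (forest⊆ es i)
  forest⊆ (e ∷ es) (here refl) | no  _ = here refl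
  forest⊆ (e ∷ es) (there i)   | no  _ = there (forest⊆ es i)

  forest-unique : ∀ {es} → Unique es → Unique (forest es)
  forest-unique [] = []
  forest-unique {e ∷ es} (e≢es ∷ uniq) with comp es (end₁ e) ≟ comp es (end₂ e)
  ... | yes _ = forest-unique uniq
  ... | no  _ = All.tabulate (λ i → All.lookup e≢es (forest⊆ es i)) ∷ forest-unique uniq

  forest-acyclic : ∀ es → ¬ CycleIn (_∈ forest es)
  forest-acyclic []       (C , inF) with inF zero
  ... | ()
  forest-acyclic (e ∷ es) (C , inF) with comp es (end₁ e) ≟ comp es (end₂ e)
  ... | yes _ = forest-acyclic es (C , inF)
  ... | no c≢ with any? (λ i → Cycle.edg C i ≟ e)
  ...   | no  none = forest-acyclic es (C , λ i → ∈-tail (inF i) λ eq → none (i , eq))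
  -- All other edges of the cycle lie in `es`, so the labels `comp es` agree along them and hence
  -- across `e`; but `e` was kept because they differ there.
  ...   | yes (i , refl) = c≢ (cycle-closes (comp es) C i λ j j≢i → comp-edge (forest⊆ es (∈-tail (inF j) (j≢i ∘ Cycle.einj C))))

  -- The visited vertices form an index, so that `lookup` of this vector is directly the `vtx` field
  -- of the cycle obtained by closing the path.
  data SimplePath (P : E → Set) (v : V) : ∀ {k} → Vec V (suc k) → Set where
    [·]  : SimplePath P v (v ∷ [])
    cons : ∀ {k} {ws : Vec V k} {u w} e → P e → Joins G e u w → (∀ i → lookup (w ∷ ws) i ≢ u) →
           SimplePath P v (w ∷ ws) → SimplePath P v (u ∷ w ∷ ws)

  PathBetween : (E → Set) → V → V → Set
  PathBetween P u v = ∃ λ k → Σ (Vec V k) λ ws → SimplePath P v (u ∷ ws)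

  suffix : ∀ {P v k} {vs : Vec V (suc k)} → SimplePath P v vs → ∀ i → PathBetween P (lookup vs i) v
  suffix {vs = _ ∷ ws} p zero        = _ , ws , p
  suffix (cons _ _ _ _ p)    (suc i) = suffix p i

  -- If `u` already lies on the path, the new edge would close a detour; the suffix starting at `u`
  -- is taken instead, which keeps the path simple.
  path-step : ∀ {P u w v} e → P e → Joins G e u w → PathBetween P w v → PathBetween P u v
  path-step {P} {u} {w} {v} e Pe j (k , ws , p) with any? (λ i → lookup (w ∷ ws) i ≟ u)
  ... | yes (i , eq) = subst (λ x → PathBetween P x v) eq (suffix p i)
  ... | no  fresh    = _ , _ , cons e Pe j (λ i eq → fresh (i , eq)) p

  path-trans : ∀ {P u w v} → PathBetween P u w → PathBetween P w v → PathBetween P u v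
  path-trans (_ , _ , [·])             q = q
  path-trans (_ , _ , cons e Pe j _ p) q = path-step e Pe j (path-trans (_ , _ , p) q)

  path-mono : ∀ {P Q : E → Set} {v k} {vs : Vec V (suc k)} → (∀ {e} → P e → Q e) →
    SimplePath P v vs → SimplePath Q v vs
  path-mono P⊆Q [·]               = [·]
  path-mono P⊆Q (cons e Pe j f p) = cons e (P⊆Q Pe) j f (path-mono P⊆Q p)

  comp-≡⇒path : ∀ es {x y} → comp es x ≡ comp es y → PathBetween (_∈ es) x y
  comp-≡⇒path []       refl = _ , _ , [·]
  comp-≡⇒path (e ∷ es) {x} {y} eq = go (relabel-≡⁻ _ _ eq)
    where
    old : ∀ {x y} → comp es x ≡ comp es y → PathBetween (_∈ (e ∷ es)) x y
    old p with comp-≡⇒path es p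
    ... | k , ws , q = k , ws , path-mono there q

    go : _ → PathBetween (_∈ (e ∷ es)) x y
    go (inj₁ p)              = old p
    go (inj₂ (inj₁ (p , q))) = path-trans (old p) (path-step e (here refl) (inj₁ refl) (old q))
    go (inj₂ (inj₂ (p , q))) = path-trans (old p) (path-step e (here refl) (inj₂ refl) (old q))

  module _ {P : E → Set} (e₀ : E) (e₀∉P : ¬ P e₀) where

    private
      -- The edge leaving each vertex. The final vertex has none on the path and gets the closing
      -- edge `e₀`, so edges and vertices of the cycle share one index set.
      edge : ∀ {v k} {vs : Vec V (suc k)} → SimplePath P v vs → Fin (suc k) → E
      edge [·]              zero    = e₀
      edge (cons e _ _ _ _) zero    = e
      edge (cons _ _ _ _ p) (suc i) = edge p i

      edge-joins : ∀ {v k} {vs : Vec V (suc k)} (p : SimplePath P v vs) (i : Fin k) →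
        Joins G (edge p (inject₁ i)) (lookup vs (inject₁ i)) (lookup vs (suc i))
      edge-joins (cons _ _ j _ _) zero    = j
      edge-joins (cons _ _ _ _ p) (suc i) = edge-joins p i

      edge-last : ∀ {v k} {vs : Vec V (suc k)} (p : SimplePath P v vs) → edge p (fromℕ k) ≡ e₀
      edge-last [·]              = refl
      edge-last (cons _ _ _ _ p) = edge-last p

      vertex-last : ∀ {v k} {vs : Vec V (suc k)} (p : SimplePath P v vs) → lookup vs (fromℕ k) ≡ v
      vertex-last [·]              = refl
      vertex-last (cons _ _ _ _ p) = vertex-last p

      vertex-injective : ∀ {v k} {vs : Vec V (suc k)} (p : SimplePath P v vs) {i j} →
        lookup vs i ≡ lookup vs j → i ≡ j
      vertex-injective p                {zero}  {zero}  eq = refl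
      vertex-injective (cons _ _ _ f p) {zero}  {suc j} eq = ⊥-elim (f j (sym eq))
      vertex-injective (cons _ _ _ f p) {suc i} {zero}  eq = ⊥-elim (f i eq)
      vertex-injective (cons _ _ _ f p) {suc i} {suc j} eq = cong suc (vertex-injective p eq)

      edge-P : ∀ {v k} {vs : Vec V (suc k)} (p : SimplePath P v vs) i → edge p i ≡ e₀ ⊎ P (edge p i)
      edge-P [·]               zero    = inj₁ refl
      edge-P (cons _ Pe _ _ p) zero    = inj₂ Pe
      edge-P (cons _ _ _ _ p)  (suc i) = edge-P p i

      -- Both ends of a path edge are on the path, whereas `u` is an end of `e` off the path; the
      -- closing edge `e₀` differs from `e` because it fails `P`.
      edge-fresh : ∀ {v k u w} {vs : Vec V (suc k)} {e} (p : SimplePath P v vs) → P e →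
        Joins G e u w → (∀ i → lookup vs i ≢ u) → ∀ i → edge p i ≢ e
      edge-fresh [·] Pe j f zero refl = e₀∉P Pe
      edge-fresh (cons _ _ (inj₁ eq) _ p) Pe (inj₁ refl) f zero refl = f zero (sym (cong proj₁ eq))
      edge-fresh (cons _ _ (inj₁ eq) _ p) Pe (inj₂ refl) f zero refl = f (suc zero) (sym (cong proj₂ eq))
      edge-fresh (cons _ _ (inj₂ eq) _ p) Pe (inj₁ refl) f zero refl = f (suc zero) (sym (cong proj₁ eq))
      edge-fresh (cons _ _ (inj₂ eq) _ p) Pe (inj₂ refl) f zero refl = f zero (sym (cong proj₂ eq))
      edge-fresh (cons _ _ _ _ p) Pe j f (suc i) eq = edge-fresh p Pe j (f ∘ suc) i eq

      edge-injective : ∀ {v k} {vs : Vec V (suc k)} (p : SimplePath P v vs) {i j} →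
        edge p i ≡ edge p j → i ≡ j
      edge-injective p                   {zero}  {zero}  eq = refl
      edge-injective (cons _ Pe jn f p) {zero}  {suc j} eq = ⊥-elim (edge-fresh p Pe jn f j (sym eq))
      edge-injective (cons _ Pe jn f p) {suc i} {zero}  eq = ⊥-elim (edge-fresh p Pe jn f i eq)
      edge-injective (cons _ _ _ _ p)    {suc i} {suc j} eq = cong suc (edge-injective p eq)

    path⇒cycle : PathBetween P (end₁ e₀) (end₂ e₀) → CycleIn (λ e → e ≡ e₀ ⊎ P e)
    path⇒cycle (k , ws , p) = record
      { len   = k
      ; vtx   = lookup (end₁ e₀ ∷ ws)
      ; edg   = edge p
      ; vinj  = vertex-injective p
      ; einj  = edge-injective p
      ; joins = edge-joins p
      ; close = inj₂ (trans (cong (ends G) (edge-last p)) (cong (end₁ e₀ ,_) (sym (vertex-last p))))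
      } , edge-P p

  -- An edge is rejected only if its ends are already connected, and a simple path between them then
  -- closes to a cycle. Uniqueness keeps the closing edge off that path. This dichotomy takes the
  -- place of excluded middle for independence.
  cycle-or-forest : ∀ {es} → Unique es → CycleIn (_∈ es) ⊎ forest es ≡ es
  cycle-or-forest [] = inj₂ refl
  cycle-or-forest {e ∷ es} (e≢es ∷ uniq) with cycle-or-forest uniq
  ... | inj₁ (C , inEs) = inj₁ (C , there ∘ inEs)
  ... | inj₂ eq with comp es (end₁ e) ≟ comp es (end₂ e)
  ...   | no  _ = inj₂ (cong (e ∷_) eq)
  ...   | yes c≡ with path⇒cycle e (λ e∈es → All.lookup e≢es e∈es refl) (comp-≡⇒path es c≡)
  ...     | C , inEs = inj₁ (C , λ i → cons-∈ (inEs i))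
    where
    cons-∈ : ∀ {f} → f ≡ e ⊎ f ∈ es → f ∈ e ∷ es
    cons-∈ (inj₁ refl) = here refl
    cons-∈ (inj₂ i)    = there i

  -- x and y get the same label once the labels of all vertices of W are identified.
  Linked : (V → V) → Subset (n G) → V → V → Set
  Linked c W x y = c x ≡ c y ⊎ ∃₂ λ w w′ → w ∈ˢ W × w′ ∈ˢ W × c x ≡ c w × c y ≡ c w′

  linked-sym : ∀ {c W x y} → Linked c W x y → Linked c W y x
  linked-sym (inj₁ eq)                        = inj₁ (sym eq)
  linked-sym (inj₂ (w , w′ , i , i′ , p , q)) = inj₂ (w′ , w , i′ , i , q , p)

  linked-trans : ∀ {c W x y z} → Linked c W x y → Linked c W y z → Linked c W x z
  linked-trans (inj₁ p) (inj₁ q) = inj₁ (trans p q)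
  linked-trans (inj₁ p) (inj₂ (w , w′ , i , i′ , q , r)) = inj₂ (w , w′ , i , i′ , trans p q , r)
  linked-trans (inj₂ (w , w′ , i , i′ , q , r)) (inj₁ p) = inj₂ (w , w′ , i , i′ , q , trans (sym p) r)
  linked-trans (inj₂ (w , _ , i , _ , q , _)) (inj₂ (_ , w′ , _ , i′ , _ , r)) = inj₂ (w , w′ , i , i′ , q , r)

  linked-∘ : ∀ {c W x y} (g : V → V) → Linked c W x y → Linked (g ∘ c) W x y
  linked-∘ g (inj₁ eq)                        = inj₁ (cong g eq)
  linked-∘ g (inj₂ (w , w′ , i , i′ , p , q)) = inj₂ (w , w′ , i , i′ , cong g p , cong g q)

  -- Since `u` carries the same label, it can stand in for `w` wherever `w` serves as a witness.
  linked-drop : ∀ {c W u w x y} → u ∈ˢ W → u ≢ w → c u ≡ c w → Linked c W x y → Linked c (W - w) x y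
  linked-drop u∈W u≢w eq (inj₁ p) = inj₁ p
  linked-drop {c} {W} {u} {w} u∈W u≢w eq (inj₂ (w₁ , w₂ , i₁ , i₂ , p , q)) with move w₁ i₁ | move w₂ i₂
    where
    move : ∀ v → v ∈ˢ W → ∃ λ v′ → v′ ∈ˢ W - w × c v ≡ c v′
    move v v∈W with v ≟ w
    ... | yes refl = u , x∈p∧x≢y⇒x∈p-y u∈W u≢w , sym eq
    ... | no  v≢w  = v , x∈p∧x≢y⇒x∈p-y v∈W v≢w , refl
  ... | v₁ , j₁ , r₁ | v₂ , j₂ , r₂ = inj₂ (v₁ , v₂ , j₁ , j₂ , trans p r₁ , trans q r₂)

  -- Each edge of as that is redundant in as ++ bs but not in as merges the
  -- labels of two vertices of the current W, one of which can then be dropped.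
  forest-++ : ∀ (P : V → Set) as bs W →
    (∀ {e} → e ∈ as → P (end₁ e) × P (end₂ e)) →
    (∀ {x y} → P x → P y → comp bs x ≡ comp bs y → Linked id W x y) →
    ∃ λ W′ →
      (∀ {x y} → P x → P y → comp (as ++ bs) x ≡ comp (as ++ bs) y → Linked (comp as) W′ x y) ×
      length (forest as) + (∣ W′ ∣ + length (forest bs)) ≤ ∣ W ∣ + length (forest (as ++ bs))
  forest-++ P []       bs W Pas link = W , link , ≤-refl
  forest-++ P (a ∷ as) bs W Pas link with forest-++ P as bs W (Pas ∘ there) link
  ... | W′ , link′ , bound = extend
    where
    u w : V
    u = end₁ a
    w = end₂ a

    Pu : P u
    Pu = proj₁ (Pas (here refl))

    Pw : P w
    Pw = proj₂ (Pas (here refl))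

    c : V → V
    c = comp as

    g : V → V
    g = relabel (c u) (c w)

    link″ : ∀ {x y} → P x → P y → comp (a ∷ as ++ bs) x ≡ comp (a ∷ as ++ bs) y →
      Linked (comp (a ∷ as)) W′ x y
    link″ {x} {y} Px Py eq = go (relabel-≡⁻ _ _ eq)
      where
      old : ∀ {x y} → P x → P y → comp (as ++ bs) x ≡ comp (as ++ bs) y → Linked (g ∘ c) W′ x y
      old Px Py p = linked-∘ g (link′ Px Py p)

      uw : Linked (g ∘ c) W′ u w
      uw = inj₁ (relabel-ends (c u) (c w))

      go : _ → Linked (g ∘ c) W′ x y
      go (inj₁ p)              = old Px Py p
      go (inj₂ (inj₁ (p , q))) = linked-trans (old Px Pu p) (linked-trans uw (old Pw Py q))
      go (inj₂ (inj₂ (p , q))) = linked-trans (old Px Pw p) (linked-trans (linked-sym uw) (old Pu Py q))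

    extend : ∃ λ W″ →
      (∀ {x y} → P x → P y → comp (a ∷ as ++ bs) x ≡ comp (a ∷ as ++ bs) y → Linked (comp (a ∷ as)) W″ x y) ×
      length (forest (a ∷ as)) + (∣ W″ ∣ + length (forest bs)) ≤ ∣ W ∣ + length (forest (a ∷ as ++ bs))
    extend with comp as u ≟ comp as w | comp (as ++ bs) u ≟ comp (as ++ bs) w
    ... | yes _ | yes _ = W′ , link″ , bound
    -- This case cannot occur, but it is absorbed rather than refuted: only the right side of the
    -- bound grows.
    ... | yes _ | no  _ = W′ , link″ , ≤-trans bound (+-monoʳ-≤ ∣ W ∣ (m≤n⇒m≤1+n ≤-refl))
    ... | no  _ | no  _ = W′ , link″ , ≤-trans (s≤s bound) (≤-reflexive (sym (+-suc ∣ W ∣ _)))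
    ... | no c≢ | yes c′≡ with link′ Pu Pw c′≡
    ...   | inj₁ c≡ = ⊥-elim (c≢ c≡)
    ...   | inj₂ (w₁ , w₂ , i₁ , i₂ , p , q) =
            W′ - w₂ ,
            (λ Px Py eq → linked-drop i₁ w₁≢w₂ gc≡ (link″ Px Py eq)) ,
            ≤-trans (≤-reflexive (sym (+-suc (length (forest as)) _)))
              (≤-trans (+-monoʳ-≤ (length (forest as)) (+-monoˡ-≤ (length (forest bs)) (x∈p⇒∣p-x∣<∣p∣ i₂))) bound)
      where
      w₁≢w₂ : w₁ ≢ w₂
      w₁≢w₂ eq = c≢ (trans p (trans (cong c eq) (sym q)))

      gc≡ : g (c w₁) ≡ g (c w₂)
      gc≡ = trans (cong g (sym p)) (trans (relabel-ends (c u) (c w)) (cong g q))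

  private
    M = cycleMatroid G

  cycle-or-forest-in : ∀ (I : Subset (m G)) → CycleIn (_∈ˢ I) ⊎ forest (elements I) ≡ elements I
  cycle-or-forest-in I with cycle-or-forest (elements-unique I)
  ... | inj₁ (C , inI) = inj₁ (C , λ i → ∈-elements⁻ (inI i))
  ... | inj₂ eq        = inj₂ eq

  indep⇒forest : ∀ I → Indep M I → forest (elements I) ≡ elements I
  indep⇒forest I indep with cycle-or-forest-in I
  ... | inj₁ cyc = ⊥-elim (indep cyc)
  ... | inj₂ eq  = eq

  forest⇒indep : ∀ I → forest (elements I) ≡ elements I → Indep M I
  forest⇒indep I eq (C , inI) =
    forest-acyclic (elements I) (C , λ i → subst (_ ∈_) (sym eq) (∈-elements⁺ (inI i)))

  -- Dependence alone is a doubly negated cycle; the greedy algorithm supplies an actual one.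
  dependent⇒cycle : ∀ I → ¬ Indep M I → CycleIn (_∈ˢ I)
  dependent⇒cycle I dep with cycle-or-forest-in I
  ... | inj₁ cyc = cyc
  ... | inj₂ eq  = ⊥-elim (dep (forest⇒indep I eq))

  indep? : ∀ I → Dec (Indep M I)
  indep? I with cycle-or-forest-in I
  ... | inj₁ cyc = no λ indep → indep cyc
  ... | inj₂ eq  = yes (forest⇒indep I eq)

  circuit? : ∀ C → Dec (Circuit M C)
  circuit? C = ¬? (indep? C) ×-dec
    -- Minimality quantifies over all proper subsets; it is decided by searching for a dependent
    -- one, and stability of `Indep` turns a failed search into independence.
    map′ (λ none D D⊂C → decidable-stable (indep? D) λ dep → none (D , D⊂C , dep))
         (λ all (D , D⊂C , dep) → dep (all D D⊂C))
         (¬? (anySubset? λ D → D ⊂? C ×-dec ¬? (indep? D)))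

  mball? : ∀ d e f → Dec (MBall M d e f)
  mball? d e f = (f ≟ e) ⊎-dec anySubset? λ C →
    circuit? C ×-dec ((e ∈ˢ? C) ×-dec ((f ∈ˢ? C) ×-dec (∣ C ∣ ≤? d)))

  -- Let `I` and `J` be maximum independent sets of the two sides. The greedy forest of `I` followed
  -- by `J` is independent in `X`, and `forest-++` bounds what it loses against `∣ I ∣ + ∣ J ∣` by
  -- `∣ W ∣`. That lemma can start from `W`, because two distinct ends of `I` in one component of
  -- `J` are also ends of `J`.
  rank-separation : ∀ {A B X : E → Set} (W : Subset (n G)) →
    (∀ {e} → A e → X e) → (∀ {e} → B e → X e) → (∀ {e} → A e → ¬ B e) →
    (∀ {a b v} → A a → B b → IsEnd a v → IsEnd b v → v ∈ˢ W) →
    ∀ {rA rB rX} → IsRank M A rA → IsRank M B rB → IsRank M X rX → rA + rB ≤ ∣ W ∣ + rX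
  rank-separation {A} {B} {X} W A⊆X B⊆X disj sep {rA} {rB} {rX}
    ((I , I⊆A , indI , refl) , _) ((J , J⊆B , indJ , refl) , _) (_ , maxX) =
    combine (forest-++ (IsEndOf as) as bs W ends-as (λ Px Py eq → base Px Py (comp-≡⇒ends bs eq)))
    where
    as bs : List E
    as = elements I
    bs = elements J

    ends-as : ∀ {e} → e ∈ as → IsEndOf as (end₁ e) × IsEndOf as (end₂ e)
    ends-as {e} i = (e , i , inj₁ refl) , (e , i , inj₂ refl)

    inW : ∀ {v} → IsEndOf as v → IsEndOf bs v → v ∈ˢ W
    inW (a , i , p) (b , j , q) = sep (I⊆A a (∈-elements⁻ i)) (J⊆B b (∈-elements⁻ j)) p q

    base : ∀ {x y} → IsEndOf as x → IsEndOf as y →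
      x ≡ y ⊎ IsEndOf bs x × IsEndOf bs y → Linked id W x y
    base Px Py (inj₁ eq)      = inj₁ eq
    base Px Py (inj₂ (p , q)) = inj₂ (_ , _ , inW Px p , inW Py q , refl , refl)

    K : List E
    K = forest (as ++ bs)

    unique-K : Unique K
    unique-K = forest-unique (Unique-++⁺ (elements-unique I) (elements-unique J)
      λ (i , j) → disj (I⊆A _ (∈-elements⁻ i)) (J⊆B _ (∈-elements⁻ j)))

    K⊆X : ∀ {e} → e ∈ K → X e
    K⊆X i with ∈-++⁻ as (forest⊆ (as ++ bs) i)
    ... | inj₁ j = A⊆X (I⊆A _ (∈-elements⁻ j))
    ... | inj₂ j = B⊆X (J⊆B _ (∈-elements⁻ j))

    K≤rX : length K ≤ rX
    K≤rX = ≤-trans (length≤∣p∣ (fromList K) unique-K ∈-fromList⁺)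
      (maxX (fromList K) (λ e i → K⊆X (∈-fromList⁻ K i))
        λ (C , inK) → forest-acyclic (as ++ bs) (C , λ i → ∈-fromList⁻ K (inK i)))

    combine : (∃ λ W′ → _ × length (forest as) + (∣ W′ ∣ + length (forest bs)) ≤ ∣ W ∣ + length K) →
      ∣ I ∣ + ∣ J ∣ ≤ ∣ W ∣ + rX
    combine (W′ , _ , bound) = begin
      ∣ I ∣ + ∣ J ∣                                                ≡⟨ cong₂ _+_ (length-forest I indI) (length-forest J indJ) ⟩
      length (forest as) + length (forest bs)                ≤⟨ +-monoʳ-≤ (length (forest as)) (m≤n+m _ ∣ W′ ∣) ⟩
      length (forest as) + (∣ W′ ∣ + length (forest bs))      ≤⟨ bound ⟩
      ∣ W ∣ + length K                                            ≤⟨ +-monoʳ-≤ ∣ W ∣ K≤rX ⟩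
      ∣ W ∣ + rX                                                  ∎
      where
      open ≤-Reasoning
      length-forest : ∀ L → Indep M L → ∣ L ∣ ≡ length (forest (elements L))
      length-forest L ind = trans (sym (length-elements L)) (cong length (sym (indep⇒forest L ind)))

  -- Circuits as cycles, and distances in the graph.

  -- A cycle avoiding `e` would make the proper subset `C - e` dependent.
  cycle-spans-circuit : ∀ {C} → Circuit M C → (Z : CycleIn (_∈ˢ C)) →
    ∀ {e} → e ∈ˢ C → ∃ λ i → Cycle.edg (proj₁ Z) i ≡ e
  cycle-spans-circuit {C} (_ , minimal) (Z , inC) {e} e∈C with any? (λ i → Cycle.edg Z i ≟ e)
  ... | yes found = found
  ... | no  none  = ⊥-elim (minimal (C - e) (x∈p⇒p-x⊂p e∈C)
    (Z , λ i → x∈p∧x≢y⇒x∈p-y (inC i) λ eq → none (i , eq)))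

  cycle-length : ∀ {C} (Z : CycleIn (_∈ˢ C)) → suc (Cycle.len (proj₁ Z)) ≤ ∣ C ∣
  cycle-length {C} (Z , inC) = subst (_≤ ∣ C ∣) (length-tabulate (Cycle.edg Z))
    (length≤∣p∣ C (Unique-tabulate⁺ (Cycle.einj Z)) λ i → let (j , eq) = ∈-tabulate⁻ {f = Cycle.edg Z} i in subst (_∈ˢ C) (sym eq) (inC j))

  ball-mono : ∀ {d d′ u v} → d ≤ d′ → Ball G d u v → Ball G d′ u v
  ball-mono _         (stop _)           = stop _
  ball-mono (s≤s d≤) (step e _ _ j walk) = step e _ _ j (ball-mono d≤ walk)

  ball-trans : ∀ {d d′ u v w} → Ball G d u v → Ball G d′ v w → Ball G (d + d′) u w
  ball-trans {d} (stop _)            walk′ = ball-mono (m≤n+m _ d) walk′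
  ball-trans     (step e _ _ j walk) walk′ = step e _ _ j (ball-trans walk walk′)

  joins-sym : ∀ {e u w} → Joins G e u w → Joins G e w u
  joins-sym (inj₁ p) = inj₂ p
  joins-sym (inj₂ p) = inj₁ p

  ball-sym : ∀ {d u v} → Ball G d u v → Ball G d v u
  ball-sym (stop _) = stop _
  ball-sym {_} {u} {v} (step {d} e _ _ j walk) = subst (λ d → Ball G d v u) (+-comm d 1)
    (ball-trans (ball-sym walk) (step e _ _ (joins-sym j) (stop {d = 0} _)))

  path-ball : ∀ {k} (v : Fin (suc k) → V) (e : Fin k → E) →
    (∀ i → Joins G (e i) (v (inject₁ i)) (v (suc i))) → ∀ x → Ball G k (v zero) (v x)
  path-ball         v e js zero    = stop _
  path-ball {suc k} v e js (suc x) = step (e zero) _ _ (js zero) (path-ball (v ∘ suc) (e ∘ suc) (js ∘ suc) x)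

  -- Both vertices are within `len` steps of `vtx zero`. Going through it avoids comparing positions
  -- on the cycle, at the cost of the radius `d + d`.
  cycle-ball : ∀ (Z : Cycle G) x y → Ball G (Cycle.len Z + Cycle.len Z) (Cycle.vtx Z x) (Cycle.vtx Z y)
  cycle-ball Z x y = ball-trans (ball-sym (from-zero x)) (from-zero y)
    where
    open Cycle Z
    from-zero : ∀ x → Ball G len (vtx zero) (vtx x)
    from-zero = path-ball vtx (edg ∘ inject₁) joins

  joins-end : ∀ {e u w v} → Joins G e u w → IsEnd e v → v ≡ u ⊎ v ≡ w
  joins-end (inj₁ refl) p           = p
  joins-end (inj₂ refl) (inj₁ refl) = inj₂ refl
  joins-end (inj₂ refl) (inj₂ refl) = inj₁ refl

  cycle-vertex : ∀ (Z : Cycle G) i {v} → IsEnd (Cycle.edg Z i) v → ∃ λ x → Cycle.vtx Z x ≡ v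
  cycle-vertex Z i end with view i
  ... | ‵fromℕ with joins-end (Cycle.close Z) end
  ...   | inj₁ refl = _ , refl
  ...   | inj₂ refl = _ , refl
  cycle-vertex Z i end | ‵inject₁ j with joins-end (Cycle.joins Z j) end
  ...   | inj₁ refl = _ , refl
  ...   | inj₂ refl = _ , refl

  mball⇒ball : ∀ {d e f v} → 1 ≤ d → MBall M d e f → IsEnd f v → Ball G (d + d) (end₁ e) v
  mball⇒ball         1≤d (inj₁ refl) (inj₁ refl) = stop _
  -- The second end of `e` itself is one step from the centre, which calls for `1 ≤ d`.
  mball⇒ball {d} {e} 1≤d (inj₁ refl) (inj₂ refl) =
    ball-mono (≤-trans 1≤d (m≤m+n d d)) (step e _ _ (inj₁ refl) (stop {d = 0} _))
  mball⇒ball {d} 1≤d (inj₂ (C , circ , e∈C , f∈C , C≤d)) end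
    with dependent⇒cycle C (proj₁ circ)
  ... | Z with cycle-spans-circuit circ Z e∈C | cycle-spans-circuit circ Z f∈C
  ...   | i , refl | j , refl with cycle-vertex (proj₁ Z) i (inj₁ refl) | cycle-vertex (proj₁ Z) j end
  ...     | x , p | y , refl = ball-mono (+-mono-≤ len≤d len≤d)
              (subst (λ u → Ball G _ u _) p (cycle-ball (proj₁ Z) x y))
    where
    len≤d : Cycle.len (proj₁ Z) ≤ d
    len≤d = ≤-trans (m≤n⇒m≤1+n ≤-refl) (≤-trans (cycle-length Z) C≤d)

-- Counting, in the form used by `degree`.

count : ∀ {k} → (Fin k → Bool) → ℕ
count f = ∣ tabulate f ∣

count-cong : ∀ {k} {f g : Fin k → Bool} → (∀ i → f i ≡ g i) → count f ≡ count g
count-cong eq = cong ∣_∣ (tabulate-cong eq)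

count-false : ∀ {k} (f : Fin (suc k) → Bool) → f zero ≡ false → count f ≡ count (f ∘ suc)
count-false f eq rewrite eq = refl

count-none : ∀ {k} (f : Fin k → Bool) → (∀ i → f i ≡ false) → count f ≡ 0
count-none {zero}  f none = refl
count-none {suc k} f none = trans (count-false f (none zero)) (count-none (f ∘ suc) (none ∘ suc))

count-≤1 : ∀ {k} (f : Fin k → Bool) → (∀ {i j} → f i ≡ true → f j ≡ true → i ≡ j) → count f ≤ 1
count-≤1 {zero}  f uniq = z≤n
count-≤1 {suc k} f uniq with f zero in eq
... | false = count-≤1 (f ∘ suc) λ p q → suc-injective (uniq p q)
... | true  = s≤s (≤-reflexive (count-none (f ∘ suc) others))
  where
  others : ∀ i → f (suc i) ≡ false
  others i with f (suc i) in eq′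
  ... | false = refl
  ... | true  with () ← uniq eq eq′

count-+ : ∀ a {b} (f : Fin (a + b) → Bool) → count f ≡ count (f ∘ (_↑ˡ b)) + count (f ∘ (a ↑ʳ_))
count-+ zero    f = refl
count-+ (suc a) f with f zero
... | true  = cong suc (count-+ a (f ∘ suc))
... | false = count-+ a (f ∘ suc)

≟-true⁻ : ∀ {k} {x y : Fin k} → ⌊ x ≟ y ⌋ ≡ true → x ≡ y
≟-true⁻ {x = x} {y} eq with x ≟ y
... | yes p = p
≟-true⁻ () | no _

≟-true⁺ : ∀ {k} {x y : Fin k} → x ≡ y → ⌊ x ≟ y ⌋ ≡ true
≟-true⁺ {x = x} {y} p with x ≟ y
... | yes _   = refl
... | no  x≢y = ⊥-elim (x≢y p)

≟-false⁺ : ∀ {k} {x y : Fin k} → x ≢ y → ⌊ x ≟ y ⌋ ≡ false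
≟-false⁺ {x = x} {y} x≢y with x ≟ y
... | yes p = ⊥-elim (x≢y p)
... | no  _ = refl

≟-cong : ∀ {k l} {x y : Fin k} (f : Fin k → Fin l) → (f x ≡ f y → x ≡ y) → ⌊ f x ≟ f y ⌋ ≡ ⌊ x ≟ y ⌋
≟-cong {x = x} {y} f inj with x ≟ y
... | yes p   = ≟-true⁺ (cong f p)
... | no  x≢y = ≟-false⁺ (x≢y ∘ inj)

walk-snoc : ∀ {G : Graph} {P : Fin (m G) → Set} {d u v w} e → P e → Joins G e v w →
  Walk G (λ _ → ⊤) P d u v → Walk G (λ _ → ⊤) P (suc d) u w
walk-snoc e Pe j (stop _)              = step e Pe _ j (stop _)
walk-snoc e Pe j (step f Pf _ jf walk) = step f Pf _ jf (walk-snoc e Pe j walk)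

-- Binary trees and their parent arrays

data BinTree (A : Set) : Set where
  leaf : A → BinTree A
  node : BinTree A → BinTree A → BinTree A

leaves : ∀ {A} → BinTree A → List A
leaves (leaf a)   = a ∷ []
leaves (node l r) = leaves l ++ leaves r

AllSub : ∀ {A} → (List A → Set) → BinTree A → Set
AllSub P (leaf a)   = P (a ∷ [])
AllSub P (node l r) = P (leaves l ++ leaves r) × AllSub P l × AllSub P r

edges : ∀ {A} → BinTree A → ℕ
edges (leaf _)   = 0
edges (node l r) = suc (edges l) + suc (edges r)

-- Preorder numbering: the root is `zero`, then comes the block of the left subtree, then that of
-- the right one. Parents thus precede their children, as `parent≤` requires.
Pos : ∀ {A} → BinTree A → Set
Pos b = Fin (suc (edges b))

module _ {A : Set} where

  inl : (l r : BinTree A) → Pos l → Pos (node l r)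
  inl l r x = suc (x ↑ˡ suc (edges r))

  inr : (l r : BinTree A) → Pos r → Pos (node l r)
  inr l r y = suc (suc (edges l) ↑ʳ y)

  inl-injective : ∀ l r {x y} → inl l r x ≡ inl l r y → x ≡ y
  inl-injective l r eq = ↑ˡ-injective (suc (edges r)) _ _ (suc-injective eq)

  inr-injective : ∀ l r {x y} → inr l r x ≡ inr l r y → x ≡ y
  inr-injective l r eq = ↑ʳ-injective (suc (edges l)) _ _ (suc-injective eq)

  inl≢inr : ∀ l r {x y} → inl l r x ≢ inr l r y
  inl≢inr l r {x} {y} eq
    with () ← trans (sym (splitAt-↑ˡ (suc (edges l)) x (suc (edges r))))
                (trans (cong (splitAt (suc (edges l))) (suc-injective eq)) (splitAt-↑ʳ (suc (edges l)) (suc (edges r)) y))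

  data PosView (l r : BinTree A) : Pos (node l r) → Set where
    root  : PosView l r zero
    left  : ∀ x → PosView l r (inl l r x)
    right : ∀ y → PosView l r (inr l r y)

  posView : ∀ l r x → PosView l r x
  posView l r zero = root
  posView l r (suc i) with splitAt (suc (edges l)) i in eq
  ... | inj₁ x = subst (PosView l r ∘ suc) (splitAt⁻¹-↑ˡ {suc (edges l)} {i = i} eq) (left x)
  ... | inj₂ y = subst (PosView l r ∘ suc) (splitAt⁻¹-↑ʳ {suc (edges l)} {i = i} eq) (right y)

  -- Functions such as `up`, `sub` and `below` are built from this eliminator, since its values at
  -- `inl` and `inr` are equations to rewrite with; `posView` contains a `subst` and serves for case
  -- distinctions in proofs.
  casePos : {B : Set} (l r : BinTree A) → B → (Pos l → B) → (Pos r → B) → Pos (node l r) → B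
  casePos l r z f g zero    = z
  casePos l r z f g (suc i) = [ f , g ]′ (splitAt (suc (edges l)) i)

  casePos-inl : ∀ {B : Set} l r {z : B} {f g} x → casePos l r z f g (inl l r x) ≡ f x
  casePos-inl l r {_} {f} {g} x = cong [ f , g ]′ (splitAt-↑ˡ (suc (edges l)) x (suc (edges r)))

  casePos-inr : ∀ {B : Set} l r {z : B} {f g} y → casePos l r z f g (inr l r y) ≡ g y
  casePos-inr l r {_} {f} {g} y = cong [ f , g ]′ (splitAt-↑ʳ (suc (edges l)) (suc (edges r)) y)

  -- The root is its own parent.
  up : ∀ b → Pos b → Pos b
  upˡ : ∀ l r → Pos l → Pos (node l r)
  upʳ : ∀ l r → Pos r → Pos (node l r)
  up (leaf _)   _ = zero
  up (node l r)   = casePos l r zero (upˡ l r) (upʳ l r)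
  upˡ l r zero    = zero
  upˡ l r (suc i) = inl l r (up l (suc i))
  upʳ l r zero    = zero
  upʳ l r (suc i) = inr l r (up r (suc i))

  up-inl : ∀ l r x → up (node l r) (inl l r x) ≡ upˡ l r x
  up-inl l r x = casePos-inl l r {zero} {upˡ l r} {upʳ l r} x

  up-inr : ∀ l r y → up (node l r) (inr l r y) ≡ upʳ l r y
  up-inr l r y = casePos-inr l r {zero} {upˡ l r} {upʳ l r} y

  -- With `pred` the bound includes the root, and at `suc i` it is exactly `parent≤`.
  up≤ : ∀ b x → toℕ (up b x) ≤ pred (toℕ x)
  up≤ (leaf _)   x = z≤n
  up≤ (node l r) x with posView l r x
  ... | root = z≤n
  ... | left zero rewrite up-inl l r zero = z≤n
  ... | left (suc i) rewrite up-inl l r (suc i)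
          | toℕ-↑ˡ (up l (suc i)) (suc (edges r)) | toℕ-↑ˡ i (suc (edges r)) = s≤s (up≤ l (suc i))
  ... | right zero rewrite up-inr l r zero = z≤n
  ... | right (suc i) rewrite up-inr l r (suc i)
          | toℕ-↑ʳ (edges l) (up r (suc i)) | toℕ-↑ʳ (edges l) (suc i) | +-suc (edges l) (toℕ i) =
            s≤s (s≤s (+-monoʳ-≤ (edges l) (up≤ r (suc i))))

  toTree : BinTree A → Tree
  toTree b = record { t = edges b ; parent = up b ∘ suc ; parent≤ = λ i → up≤ b (suc i) }

  sub : ∀ b → Pos b → BinTree A
  sub (leaf a)   _ = leaf a
  sub (node l r)   = casePos l r (node l r) (sub l) (sub r)

  sub-inl : ∀ l r x → sub (node l r) (inl l r x) ≡ sub l x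
  sub-inl l r x = casePos-inl l r {node l r} {sub l} {sub r} x

  sub-inr : ∀ l r y → sub (node l r) (inr l r y) ≡ sub r y
  sub-inr l r y = casePos-inr l r {node l r} {sub l} {sub r} y

  allSub-sub : ∀ {P} b → AllSub P b → ∀ x → P (leaves (sub b x))
  allSub-sub (leaf a)   p           x = p
  allSub-sub (node l r) (p , pl , pr) x with posView l r x
  ... | root    = p
  ... | left y  rewrite sub-inl l r y = allSub-sub l pl y
  ... | right y rewrite sub-inr l r y = allSub-sub r pr y

  children : ∀ b → Pos b → ℕ
  children b x = count (λ j → ⌊ up b (suc j) ≟ x ⌋)

  arity : BinTree A → ℕ
  arity (leaf _)   = 0
  arity (node _ _) = 2

  children-node : ∀ l r x → children (node l r) x ≡
    count (λ y → ⌊ upˡ l r y ≟ x ⌋) + count (λ y → ⌊ upʳ l r y ≟ x ⌋)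
  children-node l r x = trans (count-+ (suc (edges l)) (λ j → ⌊ up (node l r) (suc j) ≟ x ⌋))
    (cong₂ _+_ (count-cong λ y → cong (λ z → ⌊ z ≟ x ⌋) (up-inl l r y))
               (count-cong λ y → cong (λ z → ⌊ z ≟ x ⌋) (up-inr l r y)))

  -- In each block only the subtree's own root has the new root as parent; every other parent stays
  -- inside the block. So the new root counts one child per block, and a position inside a block
  -- gains none from the other.
  children≡arity : ∀ b x → children b x ≡ arity (sub b x)
  children≡arity (leaf a)   x = refl
  children≡arity (node l r) x with posView l r x
  ... | root = trans (children-node l r zero)
        (cong₂ _+_ (cong suc (count-none _ λ i → ≟-false⁺ {x = inl l r (up l (suc i))} {zero} λ ()))
                   (cong suc (count-none _ λ i → ≟-false⁺ {x = inr l r (up r (suc i))} {zero} λ ())))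
  ... | left y rewrite sub-inl l r y =
        trans (children-node l r (inl l r y)) (trans (cong₂ _+_
          (trans (count-cong {g = λ i → ⌊ up l (suc i) ≟ y ⌋} λ i → ≟-cong (inl l r) (inl-injective l r)) (children≡arity l y))
          (count-none (λ z → ⌊ upʳ l r z ≟ inl l r y ⌋) λ z → ≟-false⁺ (away z)))
          (+-identityʳ _))
    where
    away : ∀ z → upʳ l r z ≢ inl l r y
    away zero    ()
    away (suc i) eq = inl≢inr l r (sym eq)
  ... | right y rewrite sub-inr l r y =
        trans (children-node l r (inr l r y)) (cong₂ _+_
          (count-none (λ z → ⌊ upˡ l r z ≟ inr l r y ⌋) λ z → ≟-false⁺ (away z))
          (trans (count-cong {g = λ i → ⌊ up r (suc i) ≟ y ⌋} λ i → ≟-cong (inr l r) (inr-injective l r)) (children≡arity r y)))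
    where
    away : ∀ z → upˡ l r z ≢ inr l r y
    away zero    ()
    away (suc i) eq = inl≢inr l r eq

  -- The first summand of `degree` counts the edge to the parent, at most one; the second counts
  -- children. So leaves have degree at most 1 and inner nodes at most 3.
  degree-upper : ∀ b x → degree (treeGraph (toTree b)) x ≤ suc (arity (sub b x))
  degree-upper b x = +-mono-≤
    (count-≤1 (λ j → ⌊ suc j ≟ x ⌋) λ p q → suc-injective (trans (≟-true⁻ p) (sym (≟-true⁻ q))))
    (≤-reflexive (children≡arity b x))

  degree-lower : ∀ b x → arity (sub b x) ≤ degree (treeGraph (toTree b)) x
  degree-lower b x = ≤-trans (≤-reflexive (sym (children≡arity b x))) (m≤n+m _ _)

  -- Whether the second position lies in the subtree at the first. This is the computable form of
  -- reachability without the edge above that subtree.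
  below : ∀ b → Pos b → Pos b → Bool
  belowˡ : ∀ l r → Pos l → Pos (node l r) → Bool
  belowʳ : ∀ l r → Pos r → Pos (node l r) → Bool
  below (leaf _)   x = λ _ → true
  below (node l r) x = casePos l r (λ _ → true) (belowˡ l r) (belowʳ l r) x
  belowˡ l r x = casePos l r false (below l x) (λ _ → false)
  belowʳ l r x = casePos l r false (λ _ → false) (below r x)

  below-inl : ∀ l r x → below (node l r) (inl l r x) ≡ belowˡ l r x
  below-inl l r x = casePos-inl l r {λ _ → true} {belowˡ l r} {belowʳ l r} x

  below-inr : ∀ l r y → below (node l r) (inr l r y) ≡ belowʳ l r y
  below-inr l r y = casePos-inr l r {λ _ → true} {belowˡ l r} {belowʳ l r} y

  belowˡ-inl : ∀ l r x y → belowˡ l r x (inl l r y) ≡ below l x y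
  belowˡ-inl l r x y = casePos-inl l r {false} {below l x} {λ _ → false} y

  belowˡ-inr : ∀ l r x y → belowˡ l r x (inr l r y) ≡ false
  belowˡ-inr l r x y = casePos-inr l r {false} {below l x} {λ _ → false} y

  belowʳ-inl : ∀ l r x y → belowʳ l r x (inl l r y) ≡ false
  belowʳ-inl l r x y = casePos-inl l r {false} {λ _ → false} {below r x} y

  belowʳ-inr : ∀ l r x y → belowʳ l r x (inr l r y) ≡ below r x y
  belowʳ-inr l r x y = casePos-inr l r {false} {λ _ → false} {below r x} y

  below-refl : ∀ b x → below b x x ≡ true
  below-refl (leaf _)   x = refl
  below-refl (node l r) x with posView l r x
  ... | root = refl
  ... | left y rewrite below-inl l r y
          | belowˡ-inl l r y y = below-refl l y
  ... | right y rewrite below-inr l r y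
          | belowʳ-inr l r y y = below-refl r y

  below-zero : ∀ b j → below b (suc j) zero ≡ false
  below-zero (node l r) j with posView l r (suc j)
  ... | left y  rewrite below-inl l r y = refl
  ... | right y rewrite below-inr l r y = refl

  -- The edge above `x` is the only one that leaves the subtree at `x`; hence `below b x` is
  -- invariant along walks avoiding it.
  below-up : ∀ b x y → y ≢ x → below b x y ≡ below b x (up b y)
  below-up (leaf _)   x y y≢x = refl
  below-up (node l r) x y y≢x with posView l r x
  ... | root = refl
  ... | left x′ rewrite below-inl l r x′ = go (posView l r y)
    where
    c : Pos (node l r) → Bool
    c = belowˡ l r x′

    go : PosView l r y → c y ≡ c (up (node l r) y)
    go root = refl
    -- Here the parent is the root of the whole tree. Neither it nor the root of `l` lies in the
    -- subtree at `x′`, which is not the root of `l`.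
    go (left zero) = trans (belowˡ-inl l r x′ zero)
      (trans (nonroot x′ (λ eq → y≢x (cong (inl l r) (sym eq)))) (sym (cong c (up-inl l r zero))))
      where
      nonroot : ∀ x → x ≢ zero → below l x zero ≡ false
      nonroot zero    x≢0 = ⊥-elim (x≢0 refl)
      nonroot (suc j) _   = below-zero l j
    go (left (suc i)) = trans (belowˡ-inl l r x′ (suc i))
      (trans (below-up l x′ (suc i) (λ eq → y≢x (cong (inl l r) eq)))
        (sym (trans (cong c (up-inl l r (suc i))) (belowˡ-inl l r x′ (up l (suc i))))))
    go (right zero) = trans (belowˡ-inr l r x′ zero) (sym (cong c (up-inr l r zero)))
    go (right (suc i)) = trans (belowˡ-inr l r x′ (suc i))
      (sym (trans (cong c (up-inr l r (suc i))) (belowˡ-inr l r x′ (up r (suc i)))))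
  ... | right x′ rewrite below-inr l r x′ = go (posView l r y)
    where
    c : Pos (node l r) → Bool
    c = belowʳ l r x′

    go : PosView l r y → c y ≡ c (up (node l r) y)
    go root = refl
    go (right zero) = trans (belowʳ-inr l r x′ zero)
      (trans (nonroot x′ (λ eq → y≢x (cong (inr l r) (sym eq)))) (sym (cong c (up-inr l r zero))))
      where
      nonroot : ∀ x → x ≢ zero → below r x zero ≡ false
      nonroot zero    x≢0 = ⊥-elim (x≢0 refl)
      nonroot (suc j) _   = below-zero r j
    go (right (suc i)) = trans (belowʳ-inr l r x′ (suc i))
      (trans (below-up r x′ (suc i) (λ eq → y≢x (cong (inr l r) eq)))
        (sym (trans (cong c (up-inr l r (suc i))) (belowʳ-inr l r x′ (up r (suc i))))))
    go (left zero) = trans (belowʳ-inl l r x′ zero) (sym (cong c (up-inl l r zero)))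
    go (left (suc i)) = trans (belowʳ-inl l r x′ (suc i))
      (sym (trans (cong c (up-inl l r (suc i))) (belowʳ-inl l r x′ (up l (suc i)))))

  ReachAvoiding : ∀ b → Fin (edges b) → Pos b → Pos b → Set
  ReachAvoiding b j = Reach (treeGraph (toTree b)) (λ _ → ⊤) (λ i → ¬ (i ≡ j))

  reach⇒below : ∀ b j {x} → ReachAvoiding b j (suc j) x → below b (suc j) x ≡ true
  reach⇒below b j (_ , walk) = go walk (below-refl b (suc j))
    where
    go : ∀ {d u v} → Walk (treeGraph (toTree b)) (λ _ → ⊤) (λ i → ¬ (i ≡ j)) d u v →
      below b (suc j) u ≡ true → below b (suc j) v ≡ true
    go (stop _) eq = eq
    go (step i i≢j _ (inj₁ refl) walk) eq =
      go walk (trans (sym (below-up b (suc j) (suc i) (i≢j ∘ suc-injective))) eq)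
    go (step i i≢j _ (inj₂ refl) walk) eq =
      go walk (trans (below-up b (suc j) (suc i) (i≢j ∘ suc-injective)) eq)

  below⇒reach : ∀ b j x → below b (suc j) x ≡ true → ReachAvoiding b j (suc j) x
  below⇒reach b j x = go (toℕ x) x ≤-refl
    where
    -- Climb from `x` until `suc j` is met; `k` bounds the index, as `up` decreases it but is not
    -- structurally smaller.
    go : ∀ k x → toℕ x ≤ k → below b (suc j) x ≡ true → ReachAvoiding b j (suc j) x
    go k zero _ eq with () ← trans (sym (below-zero b j)) eq
    go (suc k) (suc i) (s≤s i≤k) eq with i ≟ j
    ... | yes refl = 0 , stop _
    ... | no  i≢j with go k (up b (suc i)) (≤-trans (up≤ b (suc i)) i≤k)
                        (trans (sym (below-up b (suc j) (suc i) (i≢j ∘ suc-injective))) eq)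
    ...   | d , walk = suc d , walk-snoc {G = treeGraph (toTree b)} i i≢j (inj₂ refl) walk

-- Locating labels in a tree with distinct leaves.

unique-++⁻ : ∀ {A : Set} (xs : List A) {ys} → Unique (xs ++ ys) →
  Unique xs × Unique ys × (∀ {a} → a ∈ xs → a ∉ ys)
unique-++⁻ []       u = [] , u , λ ()
unique-++⁻ (x ∷ xs) (x≢ ∷ u) with unique-++⁻ xs u
... | ux , uy , disj = All.tabulate (λ i → All.lookup x≢ (∈-++⁺ˡ i)) ∷ ux , uy ,
  λ { (here refl) j → All.lookup x≢ (∈-++⁺ʳ xs j) refl ; (there i) j → disj i j }

module _ {k : ℕ} where

  open DecMembership (_≟_ {k}) using (_∈?_)

  -- Total, as `leaf` in `BranchDec` is: a label absent from the tree ends at the rightmost leaf.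
  pos : ∀ b → Fin k → Pos b
  pos (leaf _)   a = zero
  pos (node l r) a with a ∈? leaves l
  ... | yes _ = inl l r (pos l a)
  ... | no  _ = inr l r (pos r a)

  sub-pos : ∀ b {a} → a ∈ leaves b → sub b (pos b a) ≡ leaf a
  sub-pos (leaf _) (here refl) = refl
  sub-pos (node l r) {a} i with a ∈? leaves l
  ... | yes j = trans (sub-inl l r (pos l a)) (sub-pos l j)
  ... | no a∉l with ∈-++⁻ (leaves l) i
  ...   | inj₁ j = ⊥-elim (a∉l j)
  ...   | inj₂ j = trans (sub-inr l r (pos r a)) (sub-pos r j)

  sub⊆ : ∀ (b : BinTree (Fin k)) x {a} → a ∈ leaves (sub b x) → a ∈ leaves b
  sub⊆ (leaf _)   x i = i
  sub⊆ (node l r) x {a} i with posView l r x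
  ... | root    = i
  ... | left y  = ∈-++⁺ˡ (sub⊆ l y (subst (λ s → a ∈ leaves s) (sub-inl l r y) i))
  ... | right y = ∈-++⁺ʳ (leaves l) (sub⊆ r y (subst (λ s → a ∈ leaves s) (sub-inr l r y) i))

  -- Since `pos` prefers the left subtree, a repeated label would be found only at its first
  -- occurrence; uniqueness rules this out.
  pos-sub : ∀ b → Unique (leaves b) → ∀ x {a} → sub b x ≡ leaf a → pos b a ≡ x
  pos-sub (leaf _)   u zero    eq = refl
  pos-sub (node l r) u x {a} eq with posView l r x | unique-++⁻ (leaves l) u
  pos-sub (node l r) u x {a} () | root | _
  ... | left y | ul , _ , disj with a ∈? leaves l
  ...   | yes _  = cong (inl l r) (pos-sub l ul y (trans (sym (sub-inl l r y)) eq))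
  ...   | no a∉l = ⊥-elim (a∉l (sub⊆ l y (subst (λ s → a ∈ leaves s) (sym (trans (sym (sub-inl l r y)) eq)) (here refl))))
  pos-sub (node l r) u x {a} eq | right y | _ , ur , disj with a ∈? leaves l
  ...   | yes j = ⊥-elim (disj j (sub⊆ r y (subst (λ s → a ∈ leaves s) (sym (trans (sym (sub-inr l r y)) eq)) (here refl))))
  ...   | no _  = cong (inr l r) (pos-sub r ur y (trans (sym (sub-inr l r y)) eq))

  below-pos⁻ : ∀ b {a} → a ∈ leaves b → ∀ x → below b x (pos b a) ≡ true → a ∈ leaves (sub b x)
  below-pos⁻ (leaf _)   i x eq = i
  below-pos⁻ (node l r) {a} i x eq with posView l r x
  ... | root = i
  ... | left y rewrite sub-inl l r y
                     | below-inl l r y with a ∈? leaves l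
  ...   | yes j = below-pos⁻ l j y (trans (sym (belowˡ-inl l r y (pos l a))) eq)
  ...   | no _ with () ← trans (sym (belowˡ-inr l r y (pos r a))) eq
  below-pos⁻ (node l r) {a} i x eq | right y
    rewrite sub-inr l r y
          | below-inr l r y with a ∈? leaves l
  ...   | yes _ with () ← trans (sym (belowʳ-inl l r y (pos l a))) eq
  ...   | no a∉l with ∈-++⁻ (leaves l) i
  ...     | inj₁ j = ⊥-elim (a∉l j)
  ...     | inj₂ j = below-pos⁻ r j y (trans (sym (belowʳ-inr l r y (pos r a))) eq)

  below-pos⁺ : ∀ b → Unique (leaves b) → ∀ {a} x → a ∈ leaves (sub b x) → below b x (pos b a) ≡ true
  below-pos⁺ (leaf _)   u x i = refl
  below-pos⁺ (node l r) u {a} x i with posView l r x | unique-++⁻ (leaves l) u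
  ... | root | _ = refl
  ... | left y | ul , _ , disj
        rewrite sub-inl l r y
              | below-inl l r y with a ∈? leaves l
  ...   | yes _  = trans (belowˡ-inl l r y (pos l a)) (below-pos⁺ l ul y i)
  ...   | no a∉l = ⊥-elim (a∉l (sub⊆ l y i))
  below-pos⁺ (node l r) u {a} x i | right y | _ , ur , disj
        rewrite sub-inr l r y
              | below-inr l r y with a ∈? leaves l
  ...   | yes j = ⊥-elim (disj j (sub⊆ r y i))
  ...   | no _  = trans (belowʳ-inr l r y (pos r a)) (below-pos⁺ r ur y i)

-- From tree-decompositions to branch-decompositions

module _ {A : Set} where

  leaves? : Maybe (BinTree A) → List A
  leaves? nothing  = []
  leaves? (just b) = leaves b

  AllSub? : (List A → Set) → Maybe (BinTree A) → Set
  AllSub? P nothing  = ⊤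
  AllSub? P (just b) = AllSub P b

  -- An empty piece disappears instead of becoming a leaf, because `leaf-onto` wants an element at
  -- every leaf.
  merge : Maybe (BinTree A) → Maybe (BinTree A) → Maybe (BinTree A)
  merge nothing  b        = b
  merge (just a) nothing  = just a
  merge (just a) (just b) = just (node a b)

  leaves-merge : ∀ a b → leaves? (merge a b) ≡ leaves? a ++ leaves? b
  leaves-merge nothing  b        = refl
  leaves-merge (just a) nothing  = sym (++-identityʳ (leaves a))
  leaves-merge (just a) (just b) = refl

  allSub-merge : ∀ {P} a b → AllSub? P a → AllSub? P b → P (leaves? a ++ leaves? b) → AllSub? P (merge a b)
  allSub-merge nothing  b        pa pb p = pb
  allSub-merge (just a) nothing  pa pb p = pa
  allSub-merge (just a) (just b) pa pb p = p , pa , pb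

  caterpillar : List A → Maybe (BinTree A)
  caterpillar []       = nothing
  caterpillar (a ∷ as) = merge (just (leaf a)) (caterpillar as)

  leaves-caterpillar : ∀ as → leaves? (caterpillar as) ≡ as
  leaves-caterpillar []       = refl
  leaves-caterpillar (a ∷ as) =
    trans (leaves-merge (just (leaf a)) (caterpillar as)) (cong (a ∷_) (leaves-caterpillar as))

  -- The subtrees of a caterpillar carry single entries or suffixes of the list, so `Q` holds for
  -- all their leaves.
  allSub-caterpillar : ∀ {P : List A → Set} {Q : A → Set} → (∀ bs → (∀ {b} → b ∈ bs → Q b) → P bs) →
    ∀ as → (∀ {a} → a ∈ as → Q a) → AllSub? P (caterpillar as)
  allSub-caterpillar P-if []       Qas = tt
  allSub-caterpillar {P} P-if (a ∷ as) Qas =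
    allSub-merge (just (leaf a)) (caterpillar as)
      (P-if (a ∷ []) λ { (here refl) → Qas (here refl) })
      (allSub-caterpillar P-if as (Qas ∘ there))
      (subst (λ bs → P (a ∷ bs)) (sym (leaves-caterpillar as)) (P-if (a ∷ as) Qas))

module _ (G : Graph) {S : Fin (n G) → Set} {k : ℕ} (dec : TreeDec G S k)
         {X : Fin (m G) → Set} (X? : ∀ e → Dec (X e))
         (X⊆S : ∀ {e v} → X e → IsEnd G e v → S v) where

  open TreeDec dec renaming (T to TD)

  private
    E = Fin (m G)

  loc : E → Node TD
  loc e with X? e
  ... | yes Xe = proj₁ (cover-e e (X⊆S Xe (inj₁ refl)) (X⊆S Xe (inj₂ refl)))
  -- A dummy value: only elements of `X` are ever placed in a piece.
  ... | no  _  = zero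

  loc-end : ∀ {e v} → X e → IsEnd G e v → v ∈ˢ bag (loc e)
  loc-end {e} Xe end with X? e
  ... | no ¬Xe = ⊥-elim (¬Xe Xe)
  ... | yes Xe′ with cover-e e (X⊆S Xe′ (inj₁ refl)) (X⊆S Xe′ (inj₂ refl)) | end
  ...   | _ , p , _ | inj₁ refl = p
  ...   | _ , _ , q | inj₂ refl = q

  -- The vertex boundary of `es` inside `X` lies in one bag, the future `W` of `rank-separation`.
  -- Contractions are not mentioned, so a subtree once separated stays so at all later stages.
  SeparatedBy : Node TD → List E → Set
  SeparatedBy y es = ∀ {a b v} → X a → X b → a ∈ es → b ∉ es → IsEnd G a v → IsEnd G b v → v ∈ˢ bag y

  Separated : List E → Set
  Separated es = ∃ λ y → SeparatedBy y es

  -- anc sends each node to the node it has been contracted into; an edge of TD is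
  -- either contracted or has both ends untouched.
  Contraction : (Node TD → Node TD) → Set
  Contraction anc = ∀ i → anc (suc i) ≡ anc (parent TD i) ⊎
    anc (suc i) ≡ suc i × anc (parent TD i) ≡ parent TD i

  -- A walk leaving the nodes merged into `y` must use an uncontracted edge. The near end of that
  -- edge is untouched, hence is `y` itself, and every node of the walk has `v` in its bag.
  contraction-cut : ∀ anc → Contraction anc → ∀ {v d x y z} →
    Walk (treeGraph TD) (λ w → v ∈ˢ bag w) (λ _ → ⊤) d x z → anc x ≡ y → anc z ≢ y → v ∈ˢ bag y
  contraction-cut anc con (stop _) p q = ⊥-elim (q p)
  contraction-cut anc con {v} (step i _ v∈ (inj₁ refl) walk) p q with con i
  ... | inj₁ eq       = contraction-cut anc con walk (trans (sym eq) p) q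
  ... | inj₂ (eq , _) = subst (λ w → v ∈ˢ bag w) (trans (sym eq) p) v∈
  contraction-cut anc con {v} (step i _ v∈ (inj₂ refl) walk) p q with con i
  ... | inj₁ eq       = contraction-cut anc con walk (trans eq p) q
  ... | inj₂ (_ , eq) = subst (λ w → v ∈ˢ bag w) (trans (sym eq) p) v∈

  contraction-separates : ∀ anc → Contraction anc → ∀ {y es} →
    (∀ {e} → e ∈ es → anc (loc e) ≡ y) → (∀ {e} → X e → anc (loc e) ≡ y → e ∈ es) → SeparatedBy y es
  contraction-separates anc con ∈⇒ ⇒∈ {a} {b} {v} Xa Xb a∈ b∉ va vb =
    contraction-cut anc con (proj₂ (conn v (loc a) (loc b) (loc-end Xa va) (loc-end Xb vb))) (∈⇒ a∈) (b∉ ∘ ⇒∈ Xb)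

  -- The nodes with index above s have been contracted into their parents.
  record Stage (s : ℕ) : Set where
    field
      anc         : Node TD → Node TD
      anc≤        : ∀ z → toℕ (anc z) ≤ s
      contraction : Contraction anc
      piece       : Node TD → Maybe (BinTree E)
      ∈-piece⁺    : ∀ {e} → X e → e ∈ leaves? (piece (anc (loc e)))
      ∈-piece⁻    : ∀ {e} y → e ∈ leaves? (piece y) → X e × anc (loc e) ≡ y
      unique      : ∀ y → Unique (leaves? (piece y))
      separated   : ∀ y → AllSub? Separated (piece y)

  initial : Stage (t TD)
  initial = record
    { anc         = id
    ; anc≤        = toℕ≤pred[n]
    ; contraction = λ i → inj₂ (refl , refl)
    ; piece       = caterpillar ∘ at
    ; ∈-piece⁺    = λ {e} Xe → subst (e ∈_) (sym (leaves-caterpillar (at (loc e))))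
                      (∈-filter⁺ (at? (loc e)) (∈-allFin e) (Xe , refl))
    ; ∈-piece⁻    = λ y i → at⁻ y (subst (_ ∈_) (leaves-caterpillar (at y)) i)
    ; unique      = λ y → subst Unique (sym (leaves-caterpillar (at y))) (Unique-filter⁺ (at? y) (Unique-allFin⁺ (m G)))
    ; separated   = λ y → allSub-caterpillar
                      -- Everything hung at `y` has both ends in the bag of `y`, so any selection of
                      -- it is separated by that bag.
                      (λ es at-y → y , λ { Xa _ a∈ _ va _ → subst (λ w → _ ∈ˢ bag w) (proj₂ (at-y a∈)) (loc-end Xa va) })
                      (at y) (at⁻ y)
    }
    where
    at? : ∀ y e → Dec (X e × loc e ≡ y)
    at? y e = X? e ×-dec (loc e ≟ y)

    at : Node TD → List E
    at y = filter (at? y) (allFin (m G))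

    at⁻ : ∀ y {e} → e ∈ at y → X e × loc e ≡ y
    at⁻ y i = proj₂ (∈-filter⁻ (at? y) {xs = allFin (m G)} i)

  -- All nodes after `suc j` are already contracted, so the edge to its parent is the only
  -- uncontracted one left at `suc j`, and no other edge changes its status.
  contract : ∀ {s} (j : Fin (t TD)) → toℕ j ≡ s → Stage (suc s) → Stage s
  contract {s} j refl st = record
    { anc         = anc′
    ; anc≤        = anc′≤
    ; contraction = contraction′
    ; piece       = piece′
    ; ∈-piece⁺    = ∈-piece′⁺
    ; ∈-piece⁻    = ∈-piece′⁻
    ; unique      = unique′
    ; separated   = separated′
    }
    where
    open Stage st

    x p : Node TD
    x = suc j
    p = parent TD j

    up-x : Node TD → Node TD
    up-x z with z ≟ x
    ... | yes _ = p
    ... | no  _ = z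

    up-x-≡ : up-x x ≡ p
    up-x-≡ with x ≟ x
    ... | yes _   = refl
    ... | no  x≢x = ⊥-elim (x≢x refl)

    up-x-≢ : ∀ {z} → z ≢ x → up-x z ≡ z
    up-x-≢ {z} z≢x with z ≟ x
    ... | yes z≡x = ⊥-elim (z≢x z≡x)
    ... | no  _   = refl

    parent≢ : ∀ i → parent TD i ≢ suc i
    parent≢ i eq = <-irrefl (cong toℕ eq) (s≤s (parent≤ TD i))

    anc′ : Node TD → Node TD
    anc′ z = up-x (anc z)

    anc′≤ : ∀ z → toℕ (anc′ z) ≤ toℕ j
    anc′≤ z with anc z ≟ x
    ... | yes _   = parent≤ TD j
    ... | no  ≢x  = ≤-pred (≤∧≢⇒< (anc≤ z) (≢x ∘ toℕ-injective))

    contraction′ : Contraction anc′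
    contraction′ i with contraction i
    ... | inj₁ eq = inj₁ (cong up-x eq)
    ... | inj₂ (eq , eq′) with i ≟ j
    ...   | yes refl = inj₁ (trans (trans (cong up-x eq) up-x-≡) (sym (trans (cong up-x eq′) (up-x-≢ (parent≢ i)))))
    ...   | no  i≢j  = inj₂ (trans (cong up-x eq) (up-x-≢ λ { refl → i≢j refl }) ,
                             trans (cong up-x eq′) (up-x-≢ parent≢x))
      where
      parent≢x : parent TD i ≢ x
      -- A child of `x` has an index above that of `x`, so by `anc≤` it cannot still be its own
      -- image.
      parent≢x q = <-irrefl refl
        (≤-trans (s≤s (≤-trans (≤-reflexive (sym (cong toℕ q))) (parent≤ TD i)))
                 (≤-trans (≤-reflexive (sym (cong toℕ eq))) (anc≤ (suc i))))

    merged : Maybe (BinTree E)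
    merged = merge (piece p) (piece x)

    piece′ : Node TD → Maybe (BinTree E)
    piece′ y with y ≟ p | y ≟ x
    ... | yes _ | _     = merged
    -- Emptied, as no element is sent to `x` by `anc′`.
    ... | no  _ | yes _ = nothing
    ... | no  _ | no  _ = piece y

    ∈-merged⁺ : ∀ {e} → X e → anc′ (loc e) ≡ p → e ∈ leaves? (piece p) ++ leaves? (piece x)
    ∈-merged⁺ {e} Xe eq with anc (loc e) ≟ x
    ... | yes q = ∈-++⁺ʳ (leaves? (piece p)) (subst (λ y → e ∈ leaves? (piece y)) q (∈-piece⁺ Xe))
    ... | no  _ = ∈-++⁺ˡ (subst (λ y → e ∈ leaves? (piece y)) eq (∈-piece⁺ Xe))

    ∈-merged⁻ : ∀ {e} → e ∈ leaves? (piece p) ++ leaves? (piece x) → X e × anc′ (loc e) ≡ p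
    ∈-merged⁻ i with ∈-++⁻ (leaves? (piece p)) i
    ... | inj₁ q with ∈-piece⁻ p q
    ...   | Xe , eq = Xe , trans (cong up-x eq) (up-x-≢ (parent≢ j))
    ∈-merged⁻ i | inj₂ q with ∈-piece⁻ x q
    ...   | Xe , eq = Xe , trans (cong up-x eq) up-x-≡

    ∈-piece′⁺ : ∀ {e} → X e → e ∈ leaves? (piece′ (anc′ (loc e)))
    ∈-piece′⁺ {e} Xe with anc′ (loc e) ≟ p | anc′ (loc e) ≟ x
    ... | yes eq | _ = subst (e ∈_) (sym (leaves-merge (piece p) (piece x))) (∈-merged⁺ Xe eq)
    ... | no ≢p | yes eq = ⊥-elim (<-irrefl (cong toℕ eq) (s≤s (anc′≤ (loc e))))
    ... | no ≢p | no ≢x with anc (loc e) ≟ x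
    ...   | yes _ = ⊥-elim (≢p refl)
    ...   | no  _ = ∈-piece⁺ Xe

    ∈-piece′⁻ : ∀ {e} y → e ∈ leaves? (piece′ y) → X e × anc′ (loc e) ≡ y
    ∈-piece′⁻ {e} y i with y ≟ p | y ≟ x
    ... | yes refl | _ = ∈-merged⁻ (subst (e ∈_) (leaves-merge (piece p) (piece x)) i)
    ∈-piece′⁻ y () | no _ | yes _
    ... | no _ | no ≢x with ∈-piece⁻ y i
    ...   | Xe , eq = Xe , trans (up-x-≢ λ q → ≢x (trans (sym eq) q)) eq

    unique′ : ∀ y → Unique (leaves? (piece′ y))
    unique′ y with y ≟ p | y ≟ x
    ... | yes _ | _     = subst Unique (sym (leaves-merge (piece p) (piece x)))
            (Unique-++⁺ (unique p) (unique x)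
              λ (i , i′) → parent≢ j (trans (sym (proj₂ (∈-piece⁻ p i))) (proj₂ (∈-piece⁻ x i′))))
    ... | no  _ | yes _ = []
    ... | no  _ | no  _ = unique y

    separated′ : ∀ y → AllSub? Separated (piece′ y)
    separated′ y with y ≟ p | y ≟ x
    -- Only the joined tree as a whole is new. Its leaves are all elements now sent to `p`, so the
    -- bag of `p` separates them.
    ... | yes _ | _     = allSub-merge (piece p) (piece x) (separated p) (separated x)
            (p , contraction-separates anc′ contraction′ (proj₂ ∘ ∈-merged⁻) ∈-merged⁺)
    ... | no  _ | yes _ = tt
    ... | no  _ | no  _ = separated y

  final : ∀ s → s ≤ t TD → Stage s → Stage 0
  final zero    _   st = st
  final (suc s) s<t st = final s (<⇒≤ s<t) (contract (fromℕ< s<t) (toℕ-fromℕ< s<t) st)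

  SeparatedTree : Set
  SeparatedTree = Σ (BinTree E) λ b →
    Unique (leaves b) × (∀ {e} → X e → e ∈ leaves b) × (∀ {e} → e ∈ leaves b → X e) × AllSub Separated b

  separated-tree : ∀ {e₀} → X e₀ → SeparatedTree
  separated-tree {e₀} Xe₀ = result (piece zero) refl
    where
    open Stage (final (t TD) ≤-refl initial)

    ∈-piece₀ : ∀ {e} → X e → e ∈ leaves? (piece zero)
    ∈-piece₀ {e} Xe with anc (loc e) | anc≤ (loc e) | ∈-piece⁺ Xe
    ... | zero | _ | i = i

    result : ∀ b? → piece zero ≡ b? → SeparatedTree
    -- The given element `e₀` excludes the empty tree.
    result nothing  eq with () ← subst (λ b? → e₀ ∈ leaves? b?) eq (∈-piece₀ Xe₀)
    result (just b) eq =
      b ,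
      subst (Unique ∘ leaves?) eq (unique zero) ,
      (λ {e} Xe → subst (λ b? → e ∈ leaves? b?) eq (∈-piece₀ Xe)) ,
      (λ {e} i → proj₁ (∈-piece⁻ zero (subst (λ b? → e ∈ leaves? b?) (sym eq) i))) ,
      subst (AllSub? Separated) eq (separated zero)

  -- A bag has at most `suc k` vertices, and the definition of width adds one more.
  branch-decomposition : ∀ {e₀} → X e₀ → BranchDec (cycleMatroid G) X (suc (suc k))
  branch-decomposition Xe₀ with separated-tree Xe₀
  ... | b , uniq , X⇒∈ , ∈⇒X , sep = record
    { T         = toTree b
    ; leaf      = pos b
    ; leaf-inj  = λ e f Xe Xf eq → leaf-injective (trans (sym (sub-pos b (X⇒∈ Xe))) (trans (cong (sub b) eq) (sub-pos b (X⇒∈ Xf))))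
    ; leaf-leaf = λ e Xe → subst (λ s → degree (treeGraph (toTree b)) (pos b e) ≤ suc (arity s)) (sub-pos b (X⇒∈ Xe)) (degree-upper b (pos b e))
    ; leaf-onto = onto
    ; deg≤3     = λ x → ≤-trans (degree-upper b x) (s≤s (arity≤2 (sub b x)))
    ; width     = λ j ra rb rX rankA rankB rankX →
        -- Tree edge `j` is the one above position `suc j`, so side A is the leaf set of the subtree
        -- there.
        let y , cut = allSub-sub b sep (suc j) in
        ≤-trans (≤-reflexive (+-comm (ra + rb) 1)) (s≤s (≤-trans
          (rank-separation G (bag y) proj₁ proj₁ (λ (_ , r) (_ , ¬r) → ¬r r)
            (λ (Xa , ra) (Xb , ¬rb) → cut Xa Xb
              (below-pos⁻ b (X⇒∈ Xa) (suc j) (reach⇒below b j ra))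
              (λ i → ¬rb (below⇒reach b j _ (below-pos⁺ b uniq (suc j) i))))
            rankA rankB rankX)
          (+-monoˡ-≤ rX (width y))))
    }
    where
    leaf-injective : ∀ {e f : E} → leaf e ≡ leaf f → e ≡ f
    leaf-injective refl = refl

    arity≤2 : ∀ (s : BinTree E) → arity s ≤ 2
    arity≤2 (leaf _)   = z≤n
    arity≤2 (node _ _) = ≤-refl

    onto : ∀ x → degree (treeGraph (toTree b)) x ≤ 1 → ∃ λ e → X e × pos b e ≡ x
    onto x deg≤1 with sub b x in eq | degree-lower b x
    ... | leaf e   | _     = e , ∈⇒X (sub⊆ b x (subst (λ s → e ∈ leaves s) (sym eq) (here refl))) , pos-sub b uniq x eq
    ... | node _ _ | 2≤deg with s≤s () ← ≤-trans 2≤deg deg≤1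

theorem7 : (𝒢 : Graph → Set) → LocallyBoundedTW 𝒢 →
    LocallyBoundedBW (CycleMatroidsOf 𝒢)
theorem7 𝒢 (f , tw) = (λ d → suc (suc (f (d + d)))) , λ where
  _ (G , G∈𝒢 , refl) e d 1≤d →
    branch-decomposition G (tw G G∈𝒢 (end₁ G e) (d + d)) (mball? G d e)
      (mball⇒ball G 1≤d) (inj₁ refl)
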